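{- Let $A$, $B$ and $C$ be integers with $A \geq 2$, $B \geq 1$ and $C \geq 1$, and let $p>3$ be a prime. For any integers $m \geq 1$ and $r \geq 1$, we have $$D(mp^r, A, B, C) \equiv D(mp^{r-1}, A, B, C) \pmod{p^{3r}},$$ where for a non-negative integer $n$, $$D(n, A, B, C) := \sum_{k=0}^{n} \binom{n}{k}^{A} \binom{2k}{k}^B \binom{2(n-k)}{n-k}^C.$$
   Context: The numbers $D(n,A,B,C)$ are called generalized Domb numbers; the case $A=2$, $B=C=1$ gives the Domb numbers $D(n)=\sum_{k=0}^{n} \binom{n}{k}^{2} \binom{2k}{k} \binom{2(n-k)}{n-k}$. -}

module Defs where

open import Data.Nat using (ℕ; zero; suc; _+_; _*_; _∸_; _^_)
open import Data.Nat.Combinatorics using (_C_)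

sumTo : ℕ → (ℕ → ℕ) → ℕ
sumTo zero    f = f 0
sumTo (suc n) f = sumTo n f + f (suc n)

D : ℕ → ℕ → ℕ → ℕ → ℕ
D n a b c = sumTo n (λ k → ((n C k) ^ a) * (((2 * k) C k) ^ b) * (((2 * (n ∸ k)) C (n ∸ k)) ^ c))

{-# OPTIONS --safe #-}

-- The congruence holds term by term.  Since the super Catalan numbers
-- (2k)! (2l)! / (k! l! (k + l)!) are integers, C(k + l, k) divides C(2k, k) C(2l, l), so
-- C(n, k)³ divides the k-th term T(n, k).  If pʳ divides n and s = min(r, v_p(k)), then
-- pʳ⁻ˢ divides C(n, k), hence p³⁽ʳ⁻ˢ⁾ divides T(n, k); applied to pn and r + 1, this kills
-- the terms of D(pn) with p ∤ k.  The others satisfy T(pn, pk) = T(n, k) · ρ with a p-adic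
-- unit ρ ≡ 1 (mod p³⁽ˢ⁺¹⁾) by the Jacobsthal–Kazandzidis congruence, which comes from pairing
-- j with q − j in ∏ (iq + j) over p ∤ j < q = pˢ⁺¹, and from Σ 1/j² ≡ 0 (mod q).
module Submission where

open import Defs
open import Algebra.Bundles using (CommutativeMonoid)
open import Algebra.Core using (Op₂)
import Algebra.Properties.CommutativeSemigroup as CommSemigroup
open import Algebra.Structures using (IsCommutativeMonoid)
open import Data.Bool.Base using (if_then_else_)
import Data.Integer.Base as ℤ
import Data.Integer.Divisibility as ℤ
import Data.Integer.Divisibility.Signed as ℤSigned
import Data.Integer.Properties as ℤ
import Data.Integer.Tactic.RingSolver as ℤSolver
open import Data.List.Base using ([]; _∷_)
open import Data.Nat
open import Data.Nat.Combinatorics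
  using (_C_; nCk≡n!/k![n-k]!; k![n∸k]!∣n!; k>n⇒nCk≡0)
open import Data.Nat.Coprimality as Coprime using (Coprime; coprime-divisor; coprime-Bézout)
open import Data.Nat.Divisibility renaming (_∣_ to infix 4 _∣ℕ_)
open import Data.Nat.DivMod using (m≡m%n+[m/n]*n; m%n<n; m/n*n≡m)
open import Data.Nat.GCD using (module Bézout)
open import Data.Nat.Primality
  using (Prime; prime⇒nonZero; prime⇒irreducible; ¬prime[1]; euclidsLemma)
open import Data.Nat.Properties
open import Data.Nat.Tactic.RingSolver using (solve; solve-∀)
open import Data.Product using (∃; ∃₂; _,_; _×_; proj₁; proj₂)
open import Data.Sum.Base using (_⊎_; inj₁; inj₂; [_,_]′)
open import Function.Base using (_∘′_)
open import Level using (0ℓ)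
open import Relation.Binary.Bundles using (Setoid)
open import Relation.Binary.Core using (Rel)
open import Relation.Binary.PropositionalEquality
  using (_≡_; _≢_; refl; sym; trans; cong; cong₂; subst; subst₂; module ≡-Reasoning)
import Relation.Binary.Reasoning.Setoid as SetoidReasoning
open import Relation.Binary.Structures using (IsEquivalence)
open import Relation.Nullary using (Dec; yes; no; contradiction; does)

-- Congruences between natural numbers.

infix 4 _≈_[mod_]

-- Allowing a multiple of N on both sides keeps all the algebra in the semiring ℕ.
record _≈_[mod_] (x y N : ℕ) : Set where
  constructor shifts
  field
    u v : ℕ
    eq  : x + u * N ≡ y + v * N

≈-reflexive : ∀ {N x y} → x ≡ y → x ≈ y [mod N ]
≈-reflexive refl = shifts 0 0 refl

≈-refl : ∀ {N x} → x ≈ x [mod N ]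
≈-refl = ≈-reflexive refl

≈-sym : ∀ {N x y} → x ≈ y [mod N ] → y ≈ x [mod N ]
≈-sym (shifts u v e) = shifts v u (sym e)

≈-trans : ∀ {N x y z} → x ≈ y [mod N ] → y ≈ z [mod N ] → x ≈ z [mod N ]
≈-trans {N} {x} {y} {z} (shifts u v e) (shifts u′ v′ e′) = shifts (u + u′) (v + v′) (begin
  x + (u + u′) * N      ≡⟨ solve (x ∷ u ∷ u′ ∷ N ∷ []) ⟩
  (x + u * N) + u′ * N  ≡⟨ cong (_+ u′ * N) e ⟩
  (y + v * N) + u′ * N  ≡⟨ solve (y ∷ v ∷ u′ ∷ N ∷ []) ⟩
  (y + u′ * N) + v * N  ≡⟨ cong (_+ v * N) e′ ⟩
  (z + v′ * N) + v * N  ≡⟨ solve (z ∷ v ∷ v′ ∷ N ∷ []) ⟩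
  z + (v + v′) * N      ∎)
  where open ≡-Reasoning

+-cong-≈ : ∀ {N x y x′ y′} → x ≈ y [mod N ] → x′ ≈ y′ [mod N ] → x + x′ ≈ y + y′ [mod N ]
+-cong-≈ {N} {x} {y} {x′} {y′} (shifts u v e) (shifts u′ v′ e′) = shifts (u + u′) (v + v′) (begin
  x + x′ + (u + u′) * N        ≡⟨ solve (x ∷ x′ ∷ u ∷ u′ ∷ N ∷ []) ⟩
  (x + u * N) + (x′ + u′ * N)  ≡⟨ cong₂ _+_ e e′ ⟩
  (y + v * N) + (y′ + v′ * N)  ≡⟨ solve (y ∷ y′ ∷ v ∷ v′ ∷ N ∷ []) ⟩
  y + y′ + (v + v′) * N        ∎)
  where open ≡-Reasoning

*-cong-≈ : ∀ {N x y x′ y′} → x ≈ y [mod N ] → x′ ≈ y′ [mod N ] → x * x′ ≈ y * y′ [mod N ]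
*-cong-≈ {N} {x} {y} {x′} {y′} (shifts u v e) (shifts u′ v′ e′) =
  shifts (u * x′ + x * u′ + u * N * u′) (v * y′ + y * v′ + v * N * v′) (begin
  x * x′ + (u * x′ + x * u′ + u * N * u′) * N  ≡⟨ solve (x ∷ x′ ∷ u ∷ u′ ∷ N ∷ []) ⟩
  (x + u * N) * (x′ + u′ * N)                  ≡⟨ cong₂ _*_ e e′ ⟩
  (y + v * N) * (y′ + v′ * N)                  ≡⟨ solve (y ∷ y′ ∷ v ∷ v′ ∷ N ∷ []) ⟩
  y * y′ + (v * y′ + y * v′ + v * N * v′) * N  ∎)
  where open ≡-Reasoning

*-congˡ-≈ : ∀ {N} z {x y} → x ≈ y [mod N ] → z * x ≈ z * y [mod N ]
*-congˡ-≈ z = *-cong-≈ (≈-refl {x = z})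

+-congˡ-≈ : ∀ {N} z {x y} → x ≈ y [mod N ] → z + x ≈ z + y [mod N ]
+-congˡ-≈ z = +-cong-≈ (≈-refl {x = z})

+-cancelˡ-≈ : ∀ {N} z {x y} → z + x ≈ z + y [mod N ] → x ≈ y [mod N ]
+-cancelˡ-≈ {N} z {x} {y} (shifts u v e) = shifts u v
  (+-cancelˡ-≡ z _ _ (trans (sym (+-assoc z x _)) (trans e (+-assoc z y _))))

-- This is where precision is gained: a factor divisible by `M` raises the modulus from `N` to
-- `M * N`. It turns congruences modulo q into congruences modulo q³, and lets a power of p in a
-- term add to the precision of its ratio.
*-scale-≈ : ∀ {N M z x y} → M ∣ℕ z → x ≈ y [mod N ] → z * x ≈ z * y [mod M * N ]
*-scale-≈ {N} {M} {x = x} {y} (divides c refl) (shifts u v e) = shifts (c * u) (c * v) (begin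
  c * M * x + c * u * (M * N)  ≡⟨ solve (c ∷ M ∷ x ∷ u ∷ N ∷ []) ⟩
  c * M * (x + u * N)          ≡⟨ cong (c * M *_) e ⟩
  c * M * (y + v * N)          ≡⟨ solve (c ∷ M ∷ y ∷ v ∷ N ∷ []) ⟩
  c * M * y + c * v * (M * N)  ∎)
  where open ≡-Reasoning

∣⇒≈0 : ∀ {N x} → N ∣ℕ x → x ≈ 0 [mod N ]
∣⇒≈0 (divides c refl) = shifts 0 c (+-identityʳ _)

≈⇒∣ : ∀ {N M x y} → M ∣ℕ N → x ≈ y [mod N ] → M ∣ℕ y → M ∣ℕ x
≈⇒∣ {N} {M} {x} {y} M∣N (shifts u v e) M∣y = ∣m+n∣m⇒∣n
  (subst (M ∣ℕ_) (trans (sym e) (+-comm x (u * N))) (∣m∣n⇒∣m+n M∣y (∣n⇒∣m*n v M∣N)))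
  (∣n⇒∣m*n u M∣N)

≈-isEquivalence : ∀ N → IsEquivalence (_≈_[mod N ])
≈-isEquivalence N = record { refl = ≈-refl ; sym = ≈-sym ; trans = ≈-trans }

≈-setoid : ℕ → Setoid 0ℓ 0ℓ
≈-setoid N = record { isEquivalence = ≈-isEquivalence N }

+-0-isCommutativeMonoid-≈ : ∀ N → IsCommutativeMonoid (_≈_[mod N ]) _+_ 0
+-0-isCommutativeMonoid-≈ N = record
  { isMonoid = record
    { isSemigroup = record
      { isMagma = record { isEquivalence = ≈-isEquivalence N ; ∙-cong = +-cong-≈ }
      ; assoc = λ x y z → ≈-reflexive (+-assoc x y z) }
    ; identity = (λ x → ≈-refl) , (λ x → ≈-reflexive (+-identityʳ x)) }
  ; comm = λ x y → ≈-reflexive (+-comm x y) }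

*-1-isCommutativeMonoid-≈ : ∀ N → IsCommutativeMonoid (_≈_[mod N ]) _*_ 1
*-1-isCommutativeMonoid-≈ N = record
  { isMonoid = record
    { isSemigroup = record
      { isMagma = record { isEquivalence = ≈-isEquivalence N ; ∙-cong = *-cong-≈ }
      ; assoc = λ x y z → ≈-reflexive (*-assoc x y z) }
    ; identity = (λ x → ≈-reflexive (*-identityˡ x)) , (λ x → ≈-reflexive (*-identityʳ x)) }
  ; comm = λ x y → ≈-reflexive (*-comm x y) }

-- Finite sums and products, up to equality or congruence.

module _ (_∙_ : Op₂ ℕ) (ε : ℕ) where

  -- The index runs over 0 ≤ j < n, whereas `sumTo` includes n. The relation is not a parameter, so
  -- `sum` and `prod` are the same functions whether they are compared by equality or modulo N.
  fold : ℕ → (ℕ → ℕ) → ℕ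
  fold zero    f = ε
  fold (suc n) f = fold n f ∙ f n

sum prod : ℕ → (ℕ → ℕ) → ℕ
sum  = fold _+_ 0
prod = fold _*_ 1

module Fold {_~_ : Rel ℕ 0ℓ} {_∙_ : Op₂ ℕ} {ε : ℕ} (M : IsCommutativeMonoid _~_ _∙_ ε) where

  private
    commutativeMonoid : CommutativeMonoid 0ℓ 0ℓ
    commutativeMonoid = record { isCommutativeMonoid = M }
    F = fold _∙_ ε

  open CommutativeMonoid commutativeMonoid
    using (setoid; commutativeSemigroup; assoc; comm; identityˡ; identityʳ; ∙-cong; ∙-congˡ; ∙-congʳ; reflexive)
    renaming (refl to ~-refl; sym to ~-sym; trans to ~-trans)
  open CommSemigroup commutativeSemigroup using (interchange; xy∙z≈xz∙y)
  open SetoidReasoning setoid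

  fold-cong : ∀ n {f g} → (∀ j → j < n → f j ~ g j) → F n f ~ F n g
  fold-cong zero    h = ~-refl
  fold-cong (suc n) h = ∙-cong (fold-cong n (λ j j<n → h j (m<n⇒m<1+n j<n))) (h n ≤-refl)

  fold-ε : ∀ n {f} → (∀ j → j < n → f j ~ ε) → F n f ~ ε
  fold-ε zero    h = ~-refl
  fold-ε (suc n) h = ~-trans (∙-cong (fold-ε n (λ j j<n → h j (m<n⇒m<1+n j<n))) (h n ≤-refl)) (identityˡ ε)

  fold-∙ : ∀ n f g → F n (λ j → f j ∙ g j) ~ (F n f ∙ F n g)
  fold-∙ zero    f g = ~-sym (identityˡ ε)
  fold-∙ (suc n) f g = ~-trans (∙-congʳ (fold-∙ n f g)) (interchange _ _ _ _)

  fold-+ : ∀ m n f → F (n + m) f ~ (F m f ∙ F n (λ j → f (m + j)))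
  fold-+ m zero    f = ~-sym (identityʳ _)
  fold-+ m (suc n) f = begin
    F (n + m) f ∙ f (n + m)                      ≈⟨ ∙-cong (fold-+ m n f) (reflexive (cong f (+-comm n m))) ⟩
    (F m f ∙ F n (λ j → f (m + j))) ∙ f (m + n)  ≈⟨ assoc _ _ _ ⟩
    F m f ∙ F (suc n) (λ j → f (m + j))          ∎

  fold-suc : ∀ n f → F (suc n) f ~ (f 0 ∙ F n (f ∘′ suc))
  fold-suc zero    f = comm _ _
  fold-suc (suc n) f = ~-trans (∙-congʳ (fold-suc n f)) (assoc _ _ _)

  fold-blocks : ∀ a q f → F (a * q) f ~ F a (λ i → F q (λ j → f (i * q + j)))
  fold-blocks zero    q f = ~-refl
  fold-blocks (suc a) q f = ~-trans (fold-+ (a * q) q f) (∙-congʳ (fold-blocks a q f))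

  -- The map j ↦ n - j carries 0, ..., n - 1 onto 1, ..., n, hence the shift by one on the right. It
  -- serves to pair j with q - j.
  fold-reverse : ∀ n f → F n (λ j → f (n ∸ j)) ~ F n (f ∘′ suc)
  fold-reverse zero    f = ~-refl
  fold-reverse (suc n) f = begin
    F (suc n) (λ j → f (suc n ∸ j))       ≈⟨ fold-suc n (λ j → f (suc n ∸ j)) ⟩
    f (suc n) ∙ F n (λ j → f (n ∸ j))     ≈⟨ ∙-congˡ (fold-reverse n f) ⟩
    f (suc n) ∙ F n (f ∘′ suc)             ≈⟨ comm _ _ ⟩
    F (suc n) (f ∘′ suc)                   ∎

  fold-even-odd : ∀ h f → F (h * 2) f ~ (F h (λ j → f (j * 2)) ∙ F h (λ j → f (suc (j * 2))))
  fold-even-odd zero    f = ~-sym (identityˡ ε)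
  fold-even-odd (suc h) f = begin
    (F (h * 2) f ∙ f (h * 2)) ∙ f (suc (h * 2))  ≈⟨ assoc _ _ _ ⟩
    F (h * 2) f ∙ (f (h * 2) ∙ f (suc (h * 2)))  ≈⟨ ∙-congʳ (fold-even-odd h f) ⟩
    (F h (λ j → f (j * 2)) ∙ F h (λ j → f (suc (j * 2)))) ∙ (f (h * 2) ∙ f (suc (h * 2)))
                                                 ≈⟨ interchange _ _ _ _ ⟩
    F (suc h) (λ j → f (j * 2)) ∙ F (suc h) (λ j → f (suc (j * 2)))  ∎

  -- Doubling permutes the residues modulo 1 + 2h: the doubles of 0, ..., h are the even residues,
  -- and those of h + 1, ..., 2h wrap around to the odd ones.
  fold-double : ∀ h f → (∀ j → f (j + suc (h * 2)) ~ f j) →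
                F (suc (h * 2)) (λ j → f (j * 2)) ~ F (suc (h * 2)) f
  fold-double h f periodic = begin
    F (suc (h * 2)) (λ j → f (j * 2))                        ≡⟨ cong (λ n → F n (λ j → f (j * 2))) (1+2h≡ h) ⟩
    F (h + suc h) (λ j → f (j * 2))                          ≈⟨ fold-+ (suc h) h _ ⟩
    F (suc h) (λ j → f (j * 2)) ∙ F h (λ j → f ((suc h + j) * 2))
      ≈⟨ ∙-congˡ (fold-cong h (λ j _ → ~-trans (reflexive (cong f (wrap h j))) (periodic _))) ⟩
    (F h (λ j → f (j * 2)) ∙ f (h * 2)) ∙ F h (λ j → f (suc (j * 2)))
      ≈⟨ xy∙z≈xz∙y _ _ _ ⟩
    (F h (λ j → f (j * 2)) ∙ F h (λ j → f (suc (j * 2)))) ∙ f (h * 2)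
      ≈⟨ ∙-congʳ (fold-even-odd h f) ⟨
    F (suc (h * 2)) f                                        ∎
    where
    1+2h≡ : ∀ h → 1 + h * 2 ≡ h + (1 + h)
    1+2h≡ = solve-∀
    wrap : ∀ h j → (1 + h + j) * 2 ≡ 1 + j * 2 + (1 + h * 2)
    wrap = solve-∀

  -- Each block of p consecutive indices, counted from 1, contains exactly one multiple of p, at its
  -- end. The lemma is applied to an exact product, to isolate the multiples of p in a factorial,
  -- and to a sum modulo N, to discard vanishing terms.
  fold-multiples : ∀ p .{{_ : NonZero p}} n f → (∀ k → p ∤ k → f k ~ ε) →
                   F (n * p) (f ∘′ suc) ~ F n (λ i → f (suc i * p))
  fold-multiples p@(suc p′) n f f~ε = begin
    F (n * p) (f ∘′ suc)                            ≈⟨ fold-blocks n p (f ∘′ suc) ⟩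
    F n (λ i → F p (λ j → f (suc (i * p + j))))    ≈⟨ fold-cong n (λ i _ → block i) ⟩
    F n (λ i → f (suc i * p))                      ∎
    where
    ∤-interior : ∀ i j → j < p′ → p ∤ suc (i * p + j)
    ∤-interior i j j<p′ p∣ = <⇒≱ (s<s j<p′) (∣⇒≤ (∣m+n∣m⇒∣n {m = i * p}
      (subst (p ∣ℕ_) (sym (+-suc (i * p) j)) p∣) (n∣m*n i)))

    block : ∀ i → F p (λ j → f (suc (i * p + j))) ~ f (suc i * p)
    block i = begin
      F p′ (λ j → f (suc (i * p + j))) ∙ f (suc (i * p + p′))
        ≈⟨ ∙-cong (fold-ε p′ (λ j j<p′ → f~ε _ (∤-interior i j j<p′)))
                  (reflexive (cong (f ∘′ suc) (+-comm (i * p) p′))) ⟩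
      ε ∙ f (suc i * p)  ≈⟨ identityˡ _ ⟩
      f (suc i * p)      ∎

module +-Fold = Fold +-0-isCommutativeMonoid
module *-Fold = Fold *-1-isCommutativeMonoid
module +-Fold-≈ N = Fold (+-0-isCommutativeMonoid-≈ N)
module *-Fold-≈ N = Fold (*-1-isCommutativeMonoid-≈ N)

sum-*ˡ : ∀ c n f → sum n (λ j → c * f j) ≡ c * sum n f
sum-*ˡ c zero    f = sym (*-zeroʳ c)
sum-*ˡ c (suc n) f = trans (cong (_+ c * f n) (sum-*ˡ c n f)) (sym (*-distribˡ-+ c (sum n f) (f n)))

prod-const : ∀ c n → prod n (λ _ → c) ≡ c ^ n
prod-const c zero    = refl
prod-const c (suc n) = trans (cong (_* c) (prod-const c n)) (*-comm (c ^ n) c)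

even⊎odd : ∀ n → ∃ λ h → n ≡ h * 2 ⊎ n ≡ suc (h * 2)
even⊎odd n with n % 2 | m≡m%n+[m/n]*n n 2 | m%n<n n 2
... | 0 | e | _ = n / 2 , inj₁ e
... | 1 | e | _ = n / 2 , inj₂ e
... | suc (suc _) | _ | s≤s (s≤s ())

-- Units modulo powers of a prime.

module _ {p : ℕ} (p-prime : Prime p) where

  private instance
    p≢0 : NonZero p
    p≢0 = prime⇒nonZero p-prime

  p∤1 : p ∤ 1
  p∤1 p∣1 = ¬prime[1] (subst Prime (∣1⇒≡1 p∣1) p-prime)

  ∤-* : ∀ {m n} → p ∤ m → p ∤ n → p ∤ m * n
  ∤-* {m} {n} p∤m p∤n = [ p∤m , p∤n ]′ ∘′ euclidsLemma m n p-prime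

  ∤-^ : ∀ {m} n → p ∤ m → p ∤ m ^ n
  ∤-^ zero    p∤m = p∤1
  ∤-^ (suc n) p∤m = ∤-* p∤m (∤-^ n p∤m)

  ∤-prod : ∀ n {f} → (∀ j → p ∤ f j) → p ∤ prod n f
  ∤-prod zero    p∤f = p∤1
  ∤-prod (suc n) p∤f = ∤-* (∤-prod n p∤f) (p∤f n)

  ∤⇒coprime : ∀ {c} → p ∤ c → Coprime c p
  ∤⇒coprime p∤c (d∣c , d∣p) with prime⇒irreducible p-prime d∣p
  ... | inj₁ d≡1  = d≡1
  ... | inj₂ refl = contradiction d∣c p∤c

  ∤⇒coprime-^ : ∀ {c} t → p ∤ c → Coprime c (p ^ t)
  ∤⇒coprime-^ zero    p∤c (_ , d∣1) = ∣1⇒≡1 d∣1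
  ∤⇒coprime-^ (suc t) p∤c {d} (d∣c , d∣p^t) = ∤⇒coprime-^ t p∤c
    (d∣c , coprime-divisor (λ (e∣d , e∣p) → ∤⇒coprime p∤c (∣-trans e∣d d∣c , e∣p)) d∣p^t)

  ∤⇒invertible : ∀ {c} t → p ∤ c → ∃ λ c⁻¹ → c * c⁻¹ ≈ 1 [mod p ^ t ]
  ∤⇒invertible {c} t p∤c with p ^ t | coprime-Bézout (∤⇒coprime-^ t p∤c)
  ... | q | Bézout.+- x y 1+yq≡xc = x , shifts 0 y (begin
    c * x + 0 * q  ≡⟨ solve (c ∷ x ∷ q ∷ []) ⟩
    x * c          ≡⟨ sym 1+yq≡xc ⟩
    1 + y * q      ∎)
    where open ≡-Reasoning
  -- Now x inverts − c, so x (x c) inverts c.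
  ... | q | Bézout.-+ x y 1+xc≡yq = x * (x * c) , shifts y (x * c * y) (begin
    c * (x * (x * c)) + y * q          ≡⟨ cong (c * (x * (x * c)) +_) (sym 1+xc≡yq) ⟩
    c * (x * (x * c)) + (1 + x * c)    ≡⟨ solve (c ∷ x ∷ []) ⟩
    1 + x * c * (1 + x * c)            ≡⟨ cong (λ z → 1 + x * c * z) 1+xc≡yq ⟩
    1 + x * c * (y * q)                ≡⟨ solve (c ∷ x ∷ y ∷ q ∷ []) ⟩
    1 + x * c * y * q                  ∎)
    where open ≡-Reasoning

  *-cancelˡ-≈ : ∀ {c x y} t → p ∤ c → c * x ≈ c * y [mod p ^ t ] → x ≈ y [mod p ^ t ]
  *-cancelˡ-≈ {c} {x} {y} t p∤c cx≈cy with c⁻¹ , cc⁻¹≈1 ← ∤⇒invertible t p∤c = begin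
    x                ≈⟨ unfold x ⟩
    c⁻¹ * (c * x)    ≈⟨ *-congˡ-≈ c⁻¹ cx≈cy ⟩
    c⁻¹ * (c * y)    ≈⟨ unfold y ⟨
    y                ∎
    where
    open SetoidReasoning (≈-setoid (p ^ t))
    unfold : ∀ z → z ≈ c⁻¹ * (c * z) [mod p ^ t ]
    unfold z = begin
      z                ≡⟨ sym (*-identityˡ z) ⟩
      1 * z            ≈⟨ *-cong-≈ (≈-sym cc⁻¹≈1) ≈-refl ⟩
      (c * c⁻¹) * z    ≡⟨ solve (c ∷ c⁻¹ ∷ z ∷ []) ⟩
      c⁻¹ * (c * z)    ∎

  prime∤smaller : ∀ n .{{_ : NonZero n}} → n < p → p ∤ n
  prime∤smaller n n<p p∣n = <⇒≱ n<p (∣⇒≤ p∣n)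

  odd-^ : 2 < p → ∀ t → ∃ λ h → p ^ t ≡ suc (h * 2)
  odd-^ 2<p t with even⊎odd (p ^ t)
  ... | h , inj₂ e = h , e
  ... | h , inj₁ e = contradiction (2∣⇒ t (divides h e)) λ ()
    where
    2∣⇒ : ∀ t → 2 ∣ℕ p ^ t → 2 ≡ 1
    2∣⇒ t 2∣p^t = ∤⇒coprime-^ t (prime∤smaller 2 2<p) (∣-refl , 2∣p^t)

  -- The function `w` stands for 1/j² modulo pᵗ. The value 0 at multiples of p makes its sum over
  -- all residues equal to the sum over the units, so that the doubling map can act on a full
  -- interval of indices.
  inverse-square : ∀ t → ∃ λ w → (∀ {j} → p ∣ℕ j → w j ≡ 0) × (∀ {j} → p ∤ j → j * j * w j ≈ 1 [mod p ^ t ])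
  inverse-square t = (λ j → value j (p ∣? j)) ,
    (λ {j} p∣j → on-∣ j p∣j (p ∣? j)) , (λ {j} p∤j → on-∤ j p∤j (p ∣? j))
    where
    value : ∀ j → Dec (p ∣ℕ j) → ℕ
    value j (yes _)  = 0
    value j (no p∤j) = proj₁ (∤⇒invertible t (∤-* p∤j p∤j))
    on-∣ : ∀ j → p ∣ℕ j → (d : Dec (p ∣ℕ j)) → value j d ≡ 0
    on-∣ j p∣j (yes _)  = refl
    on-∣ j p∣j (no p∤j) = contradiction p∣j p∤j
    on-∤ : ∀ j → p ∤ j → (d : Dec (p ∣ℕ j)) → j * j * value j d ≈ 1 [mod p ^ t ]
    on-∤ j p∤j (yes p∣j) = contradiction p∣j p∤j
    on-∤ j _   (no p∤j)  = proj₂ (∤⇒invertible t (∤-* p∤j p∤j))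

  -- The sum of inverse squares modulo a power of p.

  module _ (3<p : 3 < p) (t : ℕ) (p∣p^t : p ∣ℕ p ^ t) {w : ℕ → ℕ}
    (w-∣ : ∀ {j} → p ∣ℕ j → w j ≡ 0) (w-∤ : ∀ {j} → p ∤ j → j * j * w j ≈ 1 [mod p ^ t ]) where

    private
      q = p ^ t
      open SetoidReasoning (≈-setoid q)

    -- The inverses at j and j + q are chosen separately, so they agree only modulo q, as seen by
    -- cancelling j². The hypothesis `p∣p^t` amounts to t ≥ 1 and ensures that a shift by q
    -- preserves divisibility by p.
    w-periodic : ∀ j → w (j + q) ≈ w j [mod q ]
    w-periodic j with p ∣? j
    ... | yes p∣j = ≈-reflexive (trans (w-∣ (∣m∣n⇒∣m+n p∣j p∣p^t)) (sym (w-∣ p∣j)))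
    ... | no  p∤j = *-cancelˡ-≈ t (∤-* p∤j p∤j) (begin
      j * j * w (j + q)              ≈⟨ *-cong-≈ (*-cong-≈ j≈j+q j≈j+q) ≈-refl ⟩
      (j + q) * (j + q) * w (j + q)  ≈⟨ w-∤ (p∤j ∘′ λ p∣j+q → ∣m+n∣m⇒∣n (subst (p ∣ℕ_) (+-comm j q) p∣j+q) p∣p^t) ⟩
      1                              ≈⟨ w-∤ p∤j ⟨
      j * j * w j                    ∎)
      where
      j≈j+q : j ≈ j + q [mod q ]
      j≈j+q = shifts 1 0 (sym (+-assoc j q 0))

    -- Both sides invert j² modulo q, since (2j)² = 4j². Summation over j then gives 3 S ≡ 0 for the
    -- sum S, and p > 3 makes the 3 cancellable.
    w-double : ∀ j → 4 * w (j * 2) ≈ w j [mod q ]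
    w-double j with p ∣? j
    ... | yes p∣j = ≈-reflexive (trans (cong (4 *_) (w-∣ (∣m⇒∣m*n 2 p∣j))) (sym (w-∣ p∣j)))
    ... | no  p∤j = *-cancelˡ-≈ t (∤-* p∤j p∤j) (begin
      j * j * (4 * w (j * 2))        ≡⟨ rearrange j (w (j * 2)) ⟩
      j * 2 * (j * 2) * w (j * 2)    ≈⟨ w-∤ (∤-* p∤j (prime∤smaller 2 (<⇒≤ 3<p))) ⟩
      1                              ≈⟨ w-∤ p∤j ⟨
      j * j * w j                    ∎)
      where
      rearrange : ∀ j v → j * j * (4 * v) ≡ j * 2 * (j * 2) * v
      rearrange = solve-∀

    -- Doubling permutes the residues modulo the odd number q, so 4 S ≈ S for the sum S.
    sum-w≈0 : sum q w ≈ 0 [mod q ]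
    sum-w≈0 = *-cancelˡ-≈ t (prime∤smaller 3 3<p) (+-cancelˡ-≈ (sum q w) (begin
      4 * sum q w                        ≈⟨ *-congˡ-≈ 4 sum-double ⟨
      4 * sum q (λ j → w (j * 2))        ≡⟨ sum-*ˡ 4 q (λ j → w (j * 2)) ⟨
      sum q (λ j → 4 * w (j * 2))        ≈⟨ +-Fold-≈.fold-cong q q (λ j _ → w-double j) ⟩
      sum q w                            ≡⟨ sym (+-identityʳ _) ⟩
      sum q w + 0                        ∎))
      where
      sum-double : sum q (λ j → w (j * 2)) ≈ sum q w [mod q ]
      sum-double with h , q≡ ← odd-^ (<⇒≤ 3<p) t =
        subst (λ n → sum n (λ j → w (j * 2)) ≈ sum n w [mod q ]) (sym q≡)
          (+-Fold-≈.fold-double q h w (λ j → subst (λ n → w (j + n) ≈ w j [mod q ]) q≡ (w-periodic j)))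

-- First-order expansion of a product of factors 1 + x d(j): all terms of degree at least two in x
-- vanish because N divides x².
prod-perturb : ∀ {N} x → N ∣ℕ x * x → ∀ n f g d →
  (∀ j → j < n → g j ≈ f j * (1 + x * d j) [mod N ]) →
  prod n g ≈ prod n f * (1 + x * sum n d) [mod N ]
prod-perturb {N} x N∣x² zero    f g d h = ≈-reflexive (solve (x ∷ []))
prod-perturb {N} x N∣x² (suc n) f g d h = begin
  prod n g * g n                                            ≈⟨ *-cong-≈ (prod-perturb x N∣x² n f g d (λ j j<n → h j (m<n⇒m<1+n j<n))) (h n ≤-refl) ⟩
  prod n f * (1 + x * sum n d) * (f n * (1 + x * d n))      ≡⟨ expand (prod n f) (f n) x (sum n d) (d n) ⟩
  prod n f * f n * (1 + x * (sum n d + d n)) + sum n d * d n * prod n f * f n * (x * x)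
                                                            ≈⟨ +-congˡ-≈ _ (∣⇒≈0 (∣n⇒∣m*n (sum n d * d n * prod n f * f n) N∣x²)) ⟩
  prod n f * f n * (1 + x * (sum n d + d n)) + 0            ≡⟨ +-identityʳ _ ⟩
  prod n f * f n * (1 + x * (sum n d + d n))                ∎
  where
  open SetoidReasoning (≈-setoid N)
  expand : ∀ F f x S d → F * (1 + x * S) * (f * (1 + x * d)) ≡ F * f * (1 + x * (S + d)) + S * d * F * f * (x * x)
  expand = solve-∀

-- Factorials with the multiples of p removed.

module _ (p : ℕ) where

  -- The unwanted factors are replaced by 1 instead of being skipped, so every product still runs
  -- over a full interval.
  unitPart multiplePart : ℕ → ℕ
  unitPart     n = if does (p ∣? n) then 1 else n
  multiplePart n = if does (p ∣? n) then n else 1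

  unitPart-∣ : ∀ {n} → p ∣ℕ n → unitPart n ≡ 1
  unitPart-∣ {n} p∣n with p ∣? n
  ... | yes _  = refl
  ... | no p∤n = contradiction p∣n p∤n

  unitPart-∤ : ∀ {n} → p ∤ n → unitPart n ≡ n
  unitPart-∤ {n} p∤n with p ∣? n
  ... | yes p∣n = contradiction p∣n p∤n
  ... | no _    = refl

  multiplePart-∣ : ∀ {n} → p ∣ℕ n → multiplePart n ≡ n
  multiplePart-∣ {n} p∣n with p ∣? n
  ... | yes _  = refl
  ... | no p∤n = contradiction p∣n p∤n

  multiplePart-∤ : ∀ {n} → p ∤ n → multiplePart n ≡ 1
  multiplePart-∤ {n} p∤n with p ∣? n
  ... | yes p∣n = contradiction p∣n p∤n
  ... | no _    = refl

  unitPart*multiplePart : ∀ n → unitPart n * multiplePart n ≡ n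
  unitPart*multiplePart n with p ∣? n
  ... | yes _ = *-identityˡ n
  ... | no _  = *-identityʳ n

  -- For a prime p this is, up to sign, the value of Morita's p-adic Gamma function at n + 1.
  unitFactorial : ℕ → ℕ
  unitFactorial n = prod n (λ j → unitPart (suc j))

  private
    !≡prod : ∀ n → n ! ≡ prod n suc
    !≡prod zero    = refl
    !≡prod (suc n) = trans (*-comm (suc n) (n !)) (cong (_* suc n) (!≡prod n))

  -- The multiples p, 2p, ..., np of p contribute n! pⁿ, and the remaining factors form the unit
  -- factorial.
  [n*p]!-factor : .{{_ : NonZero p}} → ∀ n → (n * p) ! ≡ unitFactorial (n * p) * (n ! * p ^ n)
  [n*p]!-factor n = begin
    (n * p) !
      ≡⟨ !≡prod (n * p) ⟩
    prod (n * p) suc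
      ≡⟨ *-Fold.fold-cong (n * p) (λ j _ → sym (unitPart*multiplePart (suc j))) ⟩
    prod (n * p) (λ j → unitPart (suc j) * multiplePart (suc j))
      ≡⟨ *-Fold.fold-∙ (n * p) _ _ ⟩
    unitFactorial (n * p) * prod (n * p) (λ j → multiplePart (suc j))
      ≡⟨ cong (unitFactorial (n * p) *_) multiples ⟩
    unitFactorial (n * p) * (n ! * p ^ n)  ∎
    where
    open ≡-Reasoning
    multiples : prod (n * p) (λ j → multiplePart (suc j)) ≡ n ! * p ^ n
    multiples = begin
      prod (n * p) (λ j → multiplePart (suc j))  ≡⟨ *-Fold.fold-multiples p n multiplePart (λ _ → multiplePart-∤) ⟩
      prod n (λ i → multiplePart (suc i * p))    ≡⟨ *-Fold.fold-cong n (λ i _ → multiplePart-∣ (n∣m*n (suc i))) ⟩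
      prod n (λ i → suc i * p)                   ≡⟨ *-Fold.fold-∙ n suc (λ _ → p) ⟩
      prod n suc * prod n (λ _ → p)              ≡⟨ cong₂ _*_ (sym (!≡prod n)) (prod-const p n) ⟩
      n ! * p ^ n                                ∎

module _ {p : ℕ} (p-prime : Prime p) where

  private
    u = unitPart p

  ∤-unitPart : ∀ n → p ∤ unitPart p n
  ∤-unitPart n with p ∣? n
  ... | yes _  = p∤1 p-prime
  ... | no p∤n = p∤n

  ∤-unitFactorial : ∀ n → p ∤ unitFactorial p n
  ∤-unitFactorial n = ∤-prod p-prime n (λ j → ∤-unitPart (suc j))

  -- Blocks of length q in the unit factorial, modulo q³.

  module _ (3<p : 3 < p) (t : ℕ) (p∣p^t : p ∣ℕ p ^ t) where

    private
      q = p ^ t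

      block : ℕ → ℕ
      block i = prod q (λ j → u (suc (i * q + j)))

      paired : ℕ → ℕ → ℕ
      paired i j = u (i * q + j) * u (i * q + (q ∸ j))

      p∣iq : ∀ i → p ∣ℕ i * q
      p∣iq i = ∣n⇒∣m*n i p∣p^t

      -- As j runs through a block, so does q - j, hence the pairing produces the square of the
      -- block. A square root has to be taken afterwards.
      block-paired : ∀ i → prod q (paired i) ≡ block i * block i
      block-paired i = begin
        prod q (paired i)
          ≡⟨ *-Fold.fold-∙ q _ _ ⟩
        prod q (λ j → u (i * q + j)) * prod q (λ j → u (i * q + (q ∸ j)))
          ≡⟨ cong₂ _*_ shifted (*-Fold.fold-reverse q (λ j → u (i * q + j))) ⟩
        prod q (λ j → u (i * q + suc j)) * prod q (λ j → u (i * q + suc j))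
          ≡⟨ cong₂ _*_ +-suc-block +-suc-block ⟩
        block i * block i  ∎
        where
        open ≡-Reasoning
        f : ℕ → ℕ
        f j = u (i * q + j)
        +-suc-block : prod q (λ j → f (suc j)) ≡ block i
        +-suc-block = *-Fold.fold-cong q (λ j _ → cong u (+-suc (i * q) j))
        -- The index range moves from 0, ..., q - 1 to 1, ..., q. Nothing changes, because iq and iq
        -- + q are multiples of p and so have unit part 1.
        shifted : prod q f ≡ prod q (λ j → f (suc j))
        shifted = begin
          prod q f                           ≡⟨ sym (*-identityʳ _) ⟩
          prod q f * 1                       ≡⟨ cong (prod q f *_) (sym (unitPart-∣ p (∣m∣n⇒∣m+n (p∣iq i) p∣p^t))) ⟩
          prod (suc q) f                     ≡⟨ *-Fold.fold-suc q f ⟩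
          f 0 * prod q (λ j → f (suc j))     ≡⟨ cong (_* prod q (λ j → f (suc j))) (unitPart-∣ p (∣m∣n⇒∣m+n (p∣iq i) (p ∣0))) ⟩
          1 * prod q (λ j → f (suc j))       ≡⟨ *-identityˡ _ ⟩
          prod q (λ j → f (suc j))           ∎

      -- (iq + j)(iq + l) = i(i+1)q² + jl for j + l = q, and − 1/j² inverts jl modulo q.
      paired-perturb : ∀ {w : ℕ → ℕ} → (∀ {j} → p ∣ℕ j → w j ≡ 0) → (∀ {j} → p ∤ j → j * j * w j ≈ 1 [mod q ]) →
        ∀ i j → j < q → paired 0 j ≈ paired i j * (1 + i * suc i * (q * q) * w j) [mod q * q * q ]
      paired-perturb {w} w-∣ w-∤ i j j<q = cases (p ∣? j)
        where
        open SetoidReasoning (≈-setoid (q * q * q))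
        x = i * suc i * (q * q)
        l = q ∸ j

        j+l≡q : j + l ≡ q
        j+l≡q = m+[n∸m]≡n (<⇒≤ j<q)

        product : (i * q + j) * (i * q + l) ≡ j * l + x
        product = E.begin
          (i * q + j) * (i * q + l)                        E.≡⟨ expand i q j l ⟩
          i * i * (q * q) + i * q * (j + l) + j * l        E.≡⟨ cong (λ s → i * i * (q * q) + i * q * s + j * l) j+l≡q ⟩
          i * i * (q * q) + i * q * q + j * l              E.≡⟨ collect i q (j * l) ⟩
          j * l + x                                        E.∎
          where
          module E = ≡-Reasoning
          expand : ∀ i q j l → (i * q + j) * (i * q + l) ≡ i * i * (q * q) + i * q * (j + l) + j * l
          expand = solve-∀
          collect : ∀ i q c → i * i * (q * q) + i * q * q + c ≡ c + i * (1 + i) * (q * q)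
          collect = solve-∀

        q∣j[j+l]+x : q ∣ℕ j * (j + l) + x
        q∣j[j+l]+x = ∣m∣n⇒∣m+n (subst (λ s → q ∣ℕ j * s) (sym j+l≡q) (n∣m*n j)) (∣n⇒∣m*n (i * suc i) (n∣m*n q))

        factor : ∀ c x w → c + x * (1 + (c + x) * w) ≡ (c + x) * (1 + x * w)
        factor = solve-∀

        1+[jl+x]w≈0 : p ∤ j → 1 + (j * l + x) * w j ≈ 0 [mod q ]
        1+[jl+x]w≈0 p∤j = M.begin
          1 + (j * l + x) * w j                M.≈⟨ +-cong-≈ (w-∤ p∤j) ≈-refl ⟨
          j * j * w j + (j * l + x) * w j      M.≡⟨ collect j l x (w j) ⟩
          (j * (j + l) + x) * w j              M.≈⟨ *-cong-≈ (∣⇒≈0 q∣j[j+l]+x) ≈-refl ⟩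
          0                                    M.∎
          where
          module M = SetoidReasoning (≈-setoid q)
          collect : ∀ j l x w → j * j * w + (j * l + x) * w ≡ (j * (j + l) + x) * w
          collect = solve-∀

        cases : Dec (p ∣ℕ j) → paired 0 j ≈ paired i j * (1 + x * w j) [mod q * q * q ]
        cases (yes p∣j) = ≈-reflexive (trans (paired≡1 0) (sym (cong₂ _*_ (paired≡1 i)
          (cong suc (trans (cong (x *_) (w-∣ p∣j)) (*-zeroʳ x))))))
          where
          p∣l : p ∣ℕ l
          p∣l = ∣m+n∣m⇒∣n (subst (p ∣ℕ_) (sym j+l≡q) p∣p^t) p∣j
          paired≡1 : ∀ i → paired i j ≡ 1
          paired≡1 i = cong₂ _*_ (unitPart-∣ p (∣m∣n⇒∣m+n (p∣iq i) p∣j)) (unitPart-∣ p (∣m∣n⇒∣m+n (p∣iq i) p∣l))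
        cases (no p∤j) = begin
          u j * u l                              ≡⟨ paired-∤ 0 ⟩
          j * l                                  ≡⟨ sym (+-identityʳ _) ⟩
          j * l + 0                              ≡⟨ cong (j * l +_) (sym (*-zeroʳ x)) ⟩
          -- The factor 1 + (jl + x) w(j) vanishes only modulo q, but q² divides x, so the added
          -- term vanishes modulo q³.
          j * l + x * 0                          ≈⟨ +-congˡ-≈ (j * l) (*-scale-≈ (n∣m*n (i * suc i)) (1+[jl+x]w≈0 p∤j)) ⟨
          j * l + x * (1 + (j * l + x) * w j)    ≡⟨ factor (j * l) x (w j) ⟩
          (j * l + x) * (1 + x * w j)            ≡⟨ cong (_* (1 + x * w j)) (sym (trans (paired-∤ i) product)) ⟩
          paired i j * (1 + x * w j)             ∎
          where
          p∤l : p ∤ l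
          p∤l p∣l = p∤j (∣m+n∣m⇒∣n (subst (p ∣ℕ_) (trans (sym j+l≡q) (+-comm j l)) p∣p^t) p∣l)
          p∤iq+ : ∀ i {n} → p ∤ n → p ∤ i * q + n
          p∤iq+ i p∤n p∣ = p∤n (∣m+n∣m⇒∣n p∣ (p∣iq i))
          paired-∤ : ∀ i → paired i j ≡ (i * q + j) * (i * q + l)
          paired-∤ i = cong₂ _*_ (unitPart-∤ p (p∤iq+ i p∤j)) (unitPart-∤ p (p∤iq+ i p∤l))

      -- Multiplying the perturbed pairs gives the factor 1 + x Σ w with x = i(i + 1)q². Since q
      -- divides Σ w, the correction vanishes modulo q³.
      block²-constant : ∀ i → block 0 * block 0 ≈ block i * block i [mod q * q * q ]
      block²-constant i with w , w-∣ , w-∤ ← inverse-square p-prime t = begin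
        block 0 * block 0                   ≡⟨ sym (block-paired 0) ⟩
        prod q (paired 0)                   ≈⟨ prod-perturb x q³∣x² q (paired i) (paired 0) w (paired-perturb w-∣ w-∤ i) ⟩
        prod q (paired i) * (1 + x * sum q w)
          ≈⟨ *-congˡ-≈ (prod q (paired i)) (+-congˡ-≈ 1 (≈-trans (*-scale-≈ (n∣m*n (i * suc i)) (sum-w≈0 p-prime 3<p t p∣p^t w-∣ w-∤))
                                             (≈-reflexive (*-zeroʳ x)))) ⟩
        prod q (paired i) * (1 + 0)         ≡⟨ *-identityʳ _ ⟩
        prod q (paired i)                   ≡⟨ block-paired i ⟩
        block i * block i                   ∎
        where
        open SetoidReasoning (≈-setoid (q * q * q))
        x = i * suc i * (q * q)
        q³∣x² : q * q * q ∣ℕ x * x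
        q³∣x² = divides (i * suc i * (i * suc i) * q) (rearrange (i * suc i) q)
          where
          rearrange : ∀ a q → a * (q * q) * (a * (q * q)) ≡ a * a * q * (q * q * q)
          rearrange = solve-∀

      unitPart-periodic : ∀ {m} n → p ∣ℕ m → unitPart p (m + n) ≈ unitPart p n [mod p ]
      unitPart-periodic {m} n p∣m with p ∣? n
      ... | yes p∣n = ≈-reflexive (unitPart-∣ p (∣m∣n⇒∣m+n p∣m p∣n))
      ... | no  p∤n = ≈-trans (≈-reflexive (unitPart-∤ p (p∤n ∘′ λ p∣m+n → ∣m+n∣m⇒∣n p∣m+n p∣m)))
                              (+-cong-≈ (∣⇒≈0 p∣m) ≈-refl)

      block≈block0 : ∀ i → block i ≈ block 0 [mod p ]
      block≈block0 i = *-Fold-≈.fold-cong p q (λ j _ →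
        ≈-trans (≈-reflexive (cong u (sym (+-suc (i * q) j)))) (unitPart-periodic (suc j) (p∣iq i)))

      p^3t≡q³ : p ^ (3 * t) ≡ q * q * q
      p^3t≡q³ = trans (cong (p ^_) (*-comm 3 t)) (trans (sym (^-*-assoc p t 3)) (cube q))
        where
        cube : ∀ q → q * (q * (q * 1)) ≡ q * q * q
        cube = solve-∀

      -- From B² ≡ B₀² the sum B + B₀ can be cancelled: modulo p the blocks agree, so B + B₀ ≡ 2 B₀,
      -- and p divides neither 2 nor B₀.
      block-constant : ∀ i → block i ≈ block 0 [mod p ^ (3 * t) ]
      block-constant i = *-cancelˡ-≈ p-prime (3 * t) p∤sum (begin
        (B + B₀) * B      ≡⟨ *-distribʳ-+ B B B₀ ⟩
        B * B + B₀ * B    ≈⟨ +-cong-≈ (subst (λ N → B₀ * B₀ ≈ B * B [mod N ]) (sym p^3t≡q³) (block²-constant i)) ≈-refl ⟨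
        B₀ * B₀ + B₀ * B  ≡⟨ rearrange B B₀ ⟩
        (B + B₀) * B₀     ∎)
        where
        open SetoidReasoning (≈-setoid (p ^ (3 * t)))
        B = block i
        B₀ = block 0
        rearrange : ∀ B B₀ → B₀ * B₀ + B₀ * B ≡ (B + B₀) * B₀
        rearrange = solve-∀
        p∤sum : p ∤ B + B₀
        p∤sum p∣sum = ∤-* p-prime (prime∤smaller p-prime 2 (<⇒≤ 3<p)) (∤-unitFactorial q)
          (≈⇒∣ ∣-refl (≈-trans (≈-reflexive (cong (B₀ +_) (+-identityʳ B₀))) (+-cong-≈ (≈-sym (block≈block0 i)) ≈-refl)) p∣sum)

    -- The c blocks are all congruent to the first, which is the unit factorial of q. Addition of c
    -- thus becomes multiplication of unit factorials, as the binomial ratio requires.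
    unitFactorial-power : ∀ c → unitFactorial p (c * q) ≈ unitFactorial p q ^ c [mod p ^ (3 * t) ]
    unitFactorial-power c = begin
      unitFactorial p (c * q)    ≡⟨ *-Fold.fold-blocks c q _ ⟩
      prod c block               ≈⟨ *-Fold-≈.fold-cong (p ^ (3 * t)) c (λ i _ → block-constant i) ⟩
      prod c (λ _ → block 0)     ≡⟨ prod-const (block 0) c ⟩
      unitFactorial p q ^ c      ∎
      where open SetoidReasoning (≈-setoid (p ^ (3 * t)))

-- Binomial coefficients and super Catalan numbers.

[k+l]Ck*k!*l!≡[k+l]! : ∀ k l → ((k + l) C k) * (k ! * l !) ≡ (k + l) !
[k+l]Ck*k!*l!≡[k+l]! k l =
  subst (λ d → ((k + l) C k) * (k ! * d !) ≡ (k + l) !) (m+n∸m≡n k l) (begin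
    ((k + l) C k) * (k ! * (k + l ∸ k) !)  ≡⟨ cong (_* (k ! * (k + l ∸ k) !)) (nCk≡n!/k![n-k]! (m≤m+n k l)) ⟩
    (k + l) ! / (k ! * (k + l ∸ k) !) * (k ! * (k + l ∸ k) !)  ≡⟨ m/n*n≡m (k![n∸k]!∣n! (m≤m+n k l)) ⟩
    (k + l) !                            ∎)
  where
  open ≡-Reasoning
  instance _ = k !* (k + l ∸ k) !≢0

-- The absorption identity. It later transfers powers of p from the upper index to the binomial
-- coefficient.
suc[k]*[1+k+l]C[1+k] : ∀ k l → suc k * (suc (k + l) C suc k) ≡ suc (k + l) * ((k + l) C k)
suc[k]*[1+k+l]C[1+k] k l = *-cancelʳ-≡ _ _ (k ! * l !) (begin
  suc k * (suc (k + l) C suc k) * (k ! * l !)  ≡⟨ rearrange (suc k) (suc (k + l) C suc k) (k !) (l !) ⟩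
  (suc (k + l) C suc k) * (suc k * k ! * l !)    ≡⟨ [k+l]Ck*k!*l!≡[k+l]! (suc k) l ⟩
  suc (k + l) * (k + l) !                      ≡⟨ cong (suc (k + l) *_) (sym ([k+l]Ck*k!*l!≡[k+l]! k l)) ⟩
  suc (k + l) * (((k + l) C k) * (k ! * l !))    ≡⟨ sym (*-assoc (suc (k + l)) ((k + l) C k) (k ! * l !)) ⟩
  suc (k + l) * ((k + l) C k) * (k ! * l !)    ∎)
  where
  open ≡-Reasoning
  instance _ = k !* l !≢0
  rearrange : ∀ a c x y → a * c * (x * y) ≡ c * (a * x * y)
  rearrange = solve-∀

-- S(k, l) = (2k)! (2l)! / (k! l! (k + l)!) satisfies S(k, l + 1) = 4 S(k, l) − S(k + 1, l).
super-Catalan : ∀ k l → k ! * l ! * (k + l) ! ∣ℕ (2 * k) ! * (2 * l) !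
super-Catalan k zero = subst₂ _∣ℕ_ lhs (sym (*-identityʳ _)) (k![n∸k]!∣n! (m≤m+n k (k + 0)))
  where
  lhs : k ! * (2 * k ∸ k) ! ≡ k ! * 1 * (k + 0) !
  lhs = cong₂ _*_ (sym (*-identityʳ (k !))) (cong _! (m+n∸m≡n k (k + 0)))
super-Catalan k (suc l) with super-Catalan k l | super-Catalan (suc k) l
-- The recurrence is used with denominators cleared: S(k + 1, l) `M` plus the product in question
-- equals 4 S(k, l) `M`, so divisibility of the sum and of one summand settles the other. The
-- induction is on l with k arbitrary.
... | divides S eqS | divides S′ eqS′ = ∣m+n∣m⇒∣n (divides (4 * S) sum≡) (divides S′ summand≡)
  where
  open ≡-Reasoning
  X = (2 * k) ! * (2 * l) !
  M = k ! * suc l ! * (k + suc l) !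

  [2+2n]! : ∀ n → (2 * suc n) ! ≡ 2 * suc n * suc (2 * n) * (2 * n) !
  [2+2n]! n = trans (cong _! (*-suc 2 n)) (trans (sym (*-assoc (2 + 2 * n) (1 + 2 * n) ((2 * n) !)))
    (cong (λ z → z * suc (2 * n) * (2 * n) !) (sym (*-suc 2 n))))

  M≡ : M ≡ suc l * suc (k + l) * (k ! * l ! * (k + l) !)
  M≡ = trans (cong (λ n → k ! * suc l ! * n !) (+-suc k l)) (rearrange (k !) (l !) ((k + l) !) (suc l) (suc (k + l)))
    where
    rearrange : ∀ a b c s t → a * (s * b) * (t * c) ≡ s * t * (a * b * c)
    rearrange = solve-∀

  S′-cancelled : 2 * suc (2 * k) * X ≡ S′ * (k ! * l ! * suc (k + l) !)
  S′-cancelled = *-cancelˡ-≡ _ _ (suc k) (begin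
    suc k * (2 * suc (2 * k) * X)                      ≡⟨ rearrange (suc k) (suc (2 * k)) ((2 * k) !) ((2 * l) !) ⟩
    2 * suc k * suc (2 * k) * (2 * k) ! * (2 * l) !    ≡⟨ cong (_* (2 * l) !) (sym ([2+2n]! k)) ⟩
    (2 * suc k) ! * (2 * l) !                          ≡⟨ eqS′ ⟩
    S′ * (suc k * k ! * l ! * suc (k + l) !)           ≡⟨ rearrange′ S′ (suc k) (k !) (l !) (suc (k + l) !) ⟩
    suc k * (S′ * (k ! * l ! * suc (k + l) !))         ∎)
    where
    rearrange : ∀ a b x y → a * (2 * b * (x * y)) ≡ 2 * a * b * x * y
    rearrange = solve-∀
    rearrange′ : ∀ s a x y z → s * (a * x * y * z) ≡ a * (s * (x * y * z))
    rearrange′ = solve-∀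

  summand≡ : suc l * (2 * suc (2 * k) * X) ≡ S′ * M
  summand≡ = begin
    suc l * (2 * suc (2 * k) * X)                      ≡⟨ cong (suc l *_) S′-cancelled ⟩
    suc l * (S′ * (k ! * l ! * suc (k + l) !))         ≡⟨ rearrange (suc l) S′ (k !) (l !) (suc (k + l)) ((k + l) !) ⟩
    S′ * (suc l * suc (k + l) * (k ! * l ! * (k + l) !)) ≡⟨ cong (S′ *_) (sym M≡) ⟩
    S′ * M                                             ∎
    where
    rearrange : ∀ a s x y b z → a * (s * (x * y * (b * z))) ≡ s * (a * b * (x * y * z))
    rearrange = solve-∀

  sum≡ : suc l * (2 * suc (2 * k) * X) + (2 * k) ! * (2 * suc l) ! ≡ 4 * S * M
  sum≡ = begin
    suc l * (2 * suc (2 * k) * X) + (2 * k) ! * (2 * suc l) !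
      ≡⟨ cong (λ z → suc l * (2 * suc (2 * k) * X) + (2 * k) ! * z) ([2+2n]! l) ⟩
    suc l * (2 * suc (2 * k) * X) + (2 * k) ! * (2 * suc l * suc (2 * l) * (2 * l) !)
      ≡⟨ collect k l ((2 * k) !) ((2 * l) !) ⟩
    4 * (suc l * suc (k + l)) * X
      ≡⟨ cong (4 * (suc l * suc (k + l)) *_) eqS ⟩
    4 * (suc l * suc (k + l)) * (S * (k ! * l ! * (k + l) !))
      ≡⟨ rearrange (suc l * suc (k + l)) S (k ! * l ! * (k + l) !) ⟩
    4 * S * (suc l * suc (k + l) * (k ! * l ! * (k + l) !))
      ≡⟨ cong (4 * S *_) (sym M≡) ⟩
    4 * S * M  ∎
    where
    collect : ∀ k l x y → (1 + l) * (2 * (1 + 2 * k) * (x * y)) + x * (2 * (1 + l) * (1 + 2 * l) * y)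
                        ≡ 4 * ((1 + l) * (1 + (k + l))) * (x * y)
    collect = solve-∀
    rearrange : ∀ a s z → 4 * a * (s * z) ≡ 4 * s * (a * z)
    rearrange = solve-∀

[2n]Cn*n!*n! : ∀ n → ((2 * n) C n) * (n ! * n !) ≡ (2 * n) !
[2n]Cn*n!*n! n = subst (λ m → ((n + m) C n) * (n ! * n !) ≡ (n + m) !) (sym (+-identityʳ n)) ([k+l]Ck*k!*l!≡[k+l]! n n)

-- The quotient is the super Catalan number S(k, l), as seen after multiplying both sides by (k!
-- l!)².
[k+l]Ck∣[2k]Ck*[2l]Cl : ∀ k l → (k + l) C k ∣ℕ ((2 * k) C k) * ((2 * l) C l)
[k+l]Ck∣[2k]Ck*[2l]Cl k l = *-cancelʳ-∣ (k ! * l ! * (k ! * l !)) (subst₂ _∣ℕ_ lhs rhs (super-Catalan k l))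
  where
  open ≡-Reasoning
  instance
    _ = k !* l !≢0
    _ = m*n≢0 (k ! * l !) (k ! * l !)
  lhs : k ! * l ! * (k + l) ! ≡ ((k + l) C k) * (k ! * l ! * (k ! * l !))
  lhs = trans (cong (k ! * l ! *_) (sym ([k+l]Ck*k!*l!≡[k+l]! k l))) (rearrange (k ! * l !) ((k + l) C k))
    where
    rearrange : ∀ a c → a * (c * a) ≡ c * (a * a)
    rearrange = solve-∀
  rhs : (2 * k) ! * (2 * l) ! ≡ ((2 * k) C k) * ((2 * l) C l) * (k ! * l ! * (k ! * l !))
  rhs = trans (sym (cong₂ _*_ ([2n]Cn*n!*n! k) ([2n]Cn*n!*n! l))) (rearrange (k !) (l !) ((2 * k) C k) ((2 * l) C l))
    where
    rearrange : ∀ x y c d → c * (x * x) * (d * (y * y)) ≡ c * d * (x * y * (x * y))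
    rearrange = solve-∀

-- The summands of D and their cubic divisibility.

sumTo≡sum : ∀ n f → sumTo n f ≡ sum (suc n) f
sumTo≡sum zero    f = refl
sumTo≡sum (suc n) f = cong (_+ f (suc n)) (sumTo≡sum n f)

term : ℕ → ℕ → ℕ → ℕ → ℕ → ℕ
term a b c n k = ((n C k) ^ a) * (((2 * k) C k) ^ b) * (((2 * (n ∸ k)) C (n ∸ k)) ^ c)

^-monoʳ-∣ : ∀ x {m n} → m ≤ n → x ^ m ∣ℕ x ^ n
^-monoʳ-∣ x {m} {n} m≤n = divides (x ^ (n ∸ m)) (trans (cong (x ^_) (sym (m∸n+n≡m m≤n))) (^-distribˡ-+-* x (n ∸ m) m))

^-monoˡ-∣ : ∀ {x y} n → x ∣ℕ y → x ^ n ∣ℕ y ^ n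
^-monoˡ-∣ zero    x∣y = ∣-refl
^-monoˡ-∣ (suc n) x∣y = *-pres-∣ x∣y (^-monoˡ-∣ n x∣y)

∣-^ : ∀ x {n} → 1 ≤ n → x ∣ℕ x ^ n
∣-^ x {suc n} _ = m∣m*n (x ^ n)

-- Two factors C(n, k) come from the A-th power with A ≥ 2, the third from the product of the two
-- central binomials, where B ≥ 1 and C ≥ 1.
nCk^3∣term : ∀ {a b c} → 2 ≤ a → 1 ≤ b → 1 ≤ c → ∀ n k → (n C k) ^ 3 ∣ℕ term a b c n k
nCk^3∣term {a} {b} {c} 2≤a 1≤b 1≤c n k with k ≤? n
-- Beyond n the term is 0. This case is covered because `fold-multiples` asks for vanishing at every
-- index prime to p.
... | no k≰n = subst ((n C k) ^ 3 ∣ℕ_) (sym (trans (cong (λ z → z ^ a * B * C′) (k>n⇒nCk≡0 (≰⇒> k≰n))) (0^a≡0 2≤a))) (_ ∣0)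
  where
  B  = ((2 * k) C k) ^ b
  C′ = ((2 * (n ∸ k)) C (n ∸ k)) ^ c
  0^a≡0 : ∀ {a} → 2 ≤ a → 0 ^ a * B * C′ ≡ 0
  0^a≡0 (s≤s _) = refl
... | yes k≤n = subst₂ _∣ℕ_ (cube x) (sym (*-assoc (x ^ a) _ _))
  (*-pres-∣ (^-monoʳ-∣ x 2≤a) (∣-trans x∣central (*-pres-∣ (∣-^ _ 1≤b) (∣-^ _ 1≤c))))
  where
  x = n C k
  cube : ∀ x → x * (x * 1) * x ≡ x * (x * (x * 1))
  cube = solve-∀
  x∣central : x ∣ℕ ((2 * k) C k) * ((2 * (n ∸ k)) C (n ∸ k))
  x∣central = subst (λ m → m C k ∣ℕ ((2 * k) C k) * ((2 * (n ∸ k)) C (n ∸ k))) (m+[n∸m]≡n k≤n) ([k+l]Ck∣[2k]Ck*[2l]Cl k (n ∸ k))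

-- Powers of p in binomial coefficients, and p-adic ratios.

module _ {p : ℕ} (p-prime : Prime p) where

  private instance
    p≢0 : NonZero p
    p≢0 = prime⇒nonZero p-prime

  p^t∣m*n⇒p^t∣n : ∀ t {m n} → p ∤ m → p ^ t ∣ℕ m * n → p ^ t ∣ℕ n
  p^t∣m*n⇒p^t∣n t p∤m = coprime-divisor (Coprime.sym (∤⇒coprime-^ p-prime t p∤m))

  -- With K = k pˢ, absorption reads K C(n, K) = n C(n - 1, K - 1). The power pˢ cancels against the
  -- one in n, and k is prime to p.
  p^t∣nC[k*p^s] : ∀ s t {n k} → p ^ (s + t) ∣ℕ n → p ∤ k → p ^ t ∣ℕ n C (k * p ^ s)
  p^t∣nC[k*p^s] s t {n} {k} p^[s+t]∣n p∤k = by-size (k * p ^ s) n refl p^[s+t]∣n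
    where
    k≢0 : k ≢ 0
    k≢0 refl = p∤k (p ∣0)
    -- The lower index is generalised to `K` so that matching can expose the successor needed for
    -- absorption.
    by-size : ∀ K n → K ≡ k * p ^ s → p ^ (s + t) ∣ℕ n → p ^ t ∣ℕ n C K
    by-size zero    n K≡ _ = contradiction (m*n≡0⇒m≡0 k (p ^ s) {{m^n≢0 p s}} (sym K≡)) k≢0
    by-size (suc K) n K≡ p^∣n with suc K ≤? n
    ... | no K≰n = subst (p ^ t ∣ℕ_) (sym (k>n⇒nCk≡0 (≰⇒> K≰n))) (_ ∣0)
    by-size (suc K) (suc n) K≡ p^∣n | yes (s≤s K≤n) = p^t∣m*n⇒p^t∣n t p∤k (*-cancelˡ-∣ (p ^ s) {{m^n≢0 p s}}
      (subst₂ _∣ℕ_ (^-distribˡ-+-* p s t) absorbed (∣m⇒∣m*n (n C K) p^∣n)))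
      where
      open ≡-Reasoning
      absorbed : suc n * (n C K) ≡ p ^ s * (k * (suc n C suc K))
      absorbed = begin
        suc n * (n C K)                  ≡⟨ subst (λ m → suc m * (m C K) ≡ suc K * (suc m C suc K)) (m+[n∸m]≡n K≤n)
                                              (sym (suc[k]*[1+k+l]C[1+k] K (n ∸ K))) ⟩
        suc K * (suc n C suc K)          ≡⟨ cong (_* (suc n C suc K)) K≡ ⟩
        k * p ^ s * (suc n C suc K)      ≡⟨ rearrange k (p ^ s) (suc n C suc K) ⟩
        p ^ s * (k * (suc n C suc K))    ∎
        where
        rearrange : ∀ k q c → k * q * c ≡ q * (k * c)
        rearrange = solve-∀

  -- This computes the valuation of k capped at r: the search stops once pʳ divides k, and otherwise
  -- s is the exact valuation.
  p-adic-split : ∀ r k → p ^ r ∣ℕ k ⊎ ∃₂ λ s t → s + t ≡ r × ∃ λ k′ → k ≡ k′ * p ^ s × p ∤ k′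
  p-adic-split zero    k = inj₁ (1∣ k)
  p-adic-split (suc r) k with p-adic-split r k
  ... | inj₂ (s , t , s+t≡r , k′) = inj₂ (s , suc t , trans (+-suc s t) (cong suc s+t≡r) , k′)
  ... | inj₁ (divides k′ k≡) with p ∣? k′
  ...   | yes p∣k′ = inj₁ (subst (p ^ suc r ∣ℕ_) (sym k≡) (*-pres-∣ p∣k′ ∣-refl))
  ...   | no  p∤k′ = inj₂ (r , 1 , +-comm r 1 , k′ , k≡ , p∤k′)

  -- Whatever part of pʳ is missing from k is supplied by the binomial coefficient.
  p^s∣k×p^t∣nCk : ∀ r {n} → p ^ r ∣ℕ n → ∀ k → ∃₂ λ s t → s + t ≡ r × p ^ s ∣ℕ k × p ^ t ∣ℕ n C k
  p^s∣k×p^t∣nCk r p^r∣n k with p-adic-split r k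
  ... | inj₁ p^r∣k = r , 0 , +-identityʳ r , p^r∣k , 1∣ _
  ... | inj₂ (s , t , refl , k′ , refl , p∤k′) = s , t , refl , n∣m*n k′ , p^t∣nC[k*p^s] s t p^r∣n p∤k′

  -- The quotient x / y is p-integral and congruent to 1 modulo N.
  record UnitRatio (N x y : ℕ) : Set where
    constructor ratio
    field
      num den : ℕ
      p∤den   : p ∤ den
      num≈den : num ≈ den [mod N ]
      cross   : x * den ≡ y * num

  ratio-* : ∀ {N x y x′ y′} → UnitRatio N x y → UnitRatio N x′ y′ → UnitRatio N (x * x′) (y * y′)
  ratio-* {N} {x} {y} {x′} {y′} (ratio U V p∤V U≈V e) (ratio U′ V′ p∤V′ U′≈V′ e′) =
    ratio (U * U′) (V * V′) (∤-* p-prime p∤V p∤V′) (*-cong-≈ U≈V U′≈V′) (begin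
      x * x′ * (V * V′)      ≡⟨ rearrange x x′ V V′ ⟩
      (x * V) * (x′ * V′)    ≡⟨ cong₂ _*_ e e′ ⟩
      (y * U) * (y′ * U′)    ≡⟨ sym (rearrange y y′ U U′) ⟩
      y * y′ * (U * U′)      ∎)
    where
    open ≡-Reasoning
    rearrange : ∀ a b c d → a * b * (c * d) ≡ (a * c) * (b * d)
    rearrange = solve-∀

  ratio-^ : ∀ {N x y} n → UnitRatio N x y → UnitRatio N (x ^ n) (y ^ n)
  ratio-^ zero    R = ratio 1 1 (p∤1 p-prime) ≈-refl refl
  ratio-^ (suc n) R = ratio-* R (ratio-^ n R)

  -- Here x - y = y (U - V) / V, where y contributes pⁿ, the difference U - V contributes pᵐ, and V
  -- is a unit.
  ratio⇒≈ : ∀ {x y} m n → UnitRatio (p ^ m) x y → p ^ n ∣ℕ y → x ≈ y [mod p ^ (n + m) ]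
  ratio⇒≈ {x} {y} m n (ratio U V p∤V U≈V e) p^n∣y = *-cancelˡ-≈ p-prime (n + m) p∤V (begin
    V * x  ≡⟨ trans (*-comm V x) e ⟩
    y * U  ≈⟨ subst (λ N → y * U ≈ y * V [mod N ]) (sym (^-distribˡ-+-* p n m)) (*-scale-≈ p^n∣y U≈V) ⟩
    y * V  ≡⟨ *-comm y V ⟩
    V * y  ∎)
    where
    open SetoidReasoning (≈-setoid (p ^ (n + m)))

  -- Binomials and summands under multiplication of the indices by p.

  module _ (3<p : 3 < p) where

    -- The Jacobsthal–Kazandzidis congruence.
    C-ratio : ∀ s {k l} → p ^ s ∣ℕ k → p ^ s ∣ℕ l →
              UnitRatio (p ^ (3 * suc s)) ((k * p + l * p) C (k * p)) ((k + l) C k)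
    C-ratio s {k} {l} (divides k′ refl) (divides l′ refl) =
      ratio (U (k + l)) (U k * U l) (∤-* p-prime (∤-unitFactorial p-prime (k * p)) (∤-unitFactorial p-prime (l * p)))
        U-multiplicative
        -- After multiplication by k! l! pᵏ⁺ˡ both sides equal (kp + lp)!, by splitting each
        -- factorial into its unit part and the rest.
        (*-cancelʳ-≡ _ _ (k ! * l ! * p ^ (k + l)) (begin
          C₁ * (U k * U l) * (k ! * l ! * p ^ (k + l))
            ≡⟨ cong (λ z → C₁ * (U k * U l) * (k ! * l ! * z)) (^-distribˡ-+-* p k l) ⟩
          C₁ * (U k * U l) * (k ! * l ! * (p ^ k * p ^ l))
            ≡⟨ rearrange₁ C₁ (U k) (U l) (k !) (l !) (p ^ k) (p ^ l) ⟩
          C₁ * (U k * (k ! * p ^ k) * (U l * (l ! * p ^ l)))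
            ≡⟨ cong (C₁ *_) (sym (cong₂ _*_ ([n*p]!-factor p k) ([n*p]!-factor p l))) ⟩
          C₁ * ((k * p) ! * (l * p) !)
            ≡⟨ [k+l]Ck*k!*l!≡[k+l]! (k * p) (l * p) ⟩
          (k * p + l * p) !
            ≡⟨ cong _! (sym (*-distribʳ-+ p k l)) ⟩
          ((k + l) * p) !
            ≡⟨ [n*p]!-factor p (k + l) ⟩
          U (k + l) * ((k + l) ! * p ^ (k + l))
            ≡⟨ cong (λ z → U (k + l) * (z * p ^ (k + l))) (sym ([k+l]Ck*k!*l!≡[k+l]! k l)) ⟩
          U (k + l) * (C₀ * (k ! * l !) * p ^ (k + l))
            ≡⟨ rearrange₂ (U (k + l)) C₀ (k ! * l !) (p ^ (k + l)) ⟩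
          C₀ * U (k + l) * (k ! * l ! * p ^ (k + l))  ∎))
      where
      open ≡-Reasoning
      U : ℕ → ℕ
      U n = unitFactorial p (n * p)
      C₁ = (k * p + l * p) C (k * p)
      C₀ = (k + l) C k
      instance
        _ = k !* l !≢0
        _ = m^n≢0 p (k + l)
        _ = m*n≢0 (k ! * l !) (p ^ (k + l))
      rearrange₁ : ∀ c u v x y a b → c * (u * v) * (x * y * (a * b)) ≡ c * (u * (x * a) * (v * (y * b)))
      rearrange₁ = solve-∀
      rearrange₂ : ∀ u c x a → u * (c * x * a) ≡ c * u * (x * a)
      rearrange₂ = solve-∀
      E = unitFactorial p (p ^ suc s)
      U-power : ∀ c → U (c * p ^ s) ≈ E ^ c [mod p ^ (3 * suc s) ]
      U-power c = ≈-trans (≈-reflexive (cong (unitFactorial p) (trans (*-assoc c (p ^ s) p) (cong (c *_) (*-comm (p ^ s) p)))))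
        (unitFactorial-power p-prime 3<p (suc s) (m∣m*n (p ^ s)) c)
      -- Since pˢ divides k and l, all three unit factorials are congruent to powers of the single
      -- block `E`, and the exponents k′ and l′ add.
      U-multiplicative : U (k + l) ≈ U k * U l [mod p ^ (3 * suc s) ]
      U-multiplicative = R.begin
        U (k + l)                R.≡⟨ cong U (sym (*-distribʳ-+ (p ^ s) k′ l′)) ⟩
        U ((k′ + l′) * p ^ s)    R.≈⟨ U-power (k′ + l′) ⟩
        E ^ (k′ + l′)            R.≡⟨ ^-distribˡ-+-* E k′ l′ ⟩
        E ^ k′ * E ^ l′          R.≈⟨ *-cong-≈ (U-power k′) (U-power l′) ⟨
        U k * U l                R.∎
        where module R = SetoidReasoning (≈-setoid (p ^ (3 * suc s)))

    central-ratio : ∀ s {k} → p ^ s ∣ℕ k → UnitRatio (p ^ (3 * suc s)) ((2 * (k * p)) C (k * p)) ((2 * k) C k)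
    central-ratio s {k} p^s∣k = subst₂ (λ x y → UnitRatio (p ^ (3 * suc s)) (x C (k * p)) (y C k))
      (cong (k * p +_) (sym (+-identityʳ (k * p)))) (cong (k +_) (sym (+-identityʳ k))) (C-ratio s p^s∣k p^s∣k)

    module _ {a b c : ℕ} (2≤a : 2 ≤ a) (1≤b : 1 ≤ b) (1≤c : 1 ≤ c) where

      private
        T = term a b c

      p^t∣nCk⇒p^3t∣term : ∀ t {n k} → p ^ t ∣ℕ n C k → p ^ (3 * t) ∣ℕ T n k
      p^t∣nCk⇒p^3t∣term t {n} {k} p^t∣ = subst (_∣ℕ T n k)
        (trans (^-*-assoc p t 3) (cong (p ^_) (*-comm t 3)))
        (∣-trans (^-monoˡ-∣ 3 p^t∣) (nCk^3∣term 2≤a 1≤b 1≤c n k))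

      term-ratio : ∀ s {k l} → p ^ s ∣ℕ k → p ^ s ∣ℕ l →
        UnitRatio (p ^ (3 * suc s)) (T ((k + l) * p) (k * p)) (T (k + l) k)
      term-ratio s {k} {l} p^s∣k p^s∣l = ratio-*
        (ratio-* (ratio-^ a (subst (λ n → UnitRatio N (n C (k * p)) ((k + l) C k)) (sym (*-distribʳ-+ p k l)) (C-ratio s p^s∣k p^s∣l)))
                 (ratio-^ b (central-ratio s p^s∣k)))
        (ratio-^ c (subst₂ (λ x y → UnitRatio N ((2 * x) C x) ((2 * y) C y)) (sym [k+l]p∸kp≡lp) (sym (m+n∸m≡n k l))
          (central-ratio s p^s∣l)))
        where
        N = p ^ (3 * suc s)
        [k+l]p∸kp≡lp : (k + l) * p ∸ k * p ≡ l * p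
        [k+l]p∸kp≡lp = trans (cong (_∸ k * p) (*-distribʳ-+ p k l)) (m+n∸m≡n (k * p) (l * p))

      -- The ratio is 1 modulo p to the 3(s + 1) and the term carries p to the 3t. As s + t = r, the
      -- total 3(r + 1) does not depend on k.
      term-≈ : ∀ r {n k} → p ^ r ∣ℕ n → k ≤ n → T (n * p) (k * p) ≈ T n k [mod p ^ (3 * suc r) ]
      term-≈ r {n} {k} p^r∣n k≤n with s , t , refl , p^s∣k , p^t∣nCk ← p^s∣k×p^t∣nCk r p^r∣n k =
        subst (λ e → T (n * p) (k * p) ≈ T n k [mod p ^ e ]) (exponent s t)
          (ratio⇒≈ (3 * suc s) (3 * t)
            (subst (λ m → UnitRatio (p ^ (3 * suc s)) (T (m * p) (k * p)) (T m k)) k+l≡n (term-ratio s p^s∣k p^s∣l))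
            (p^t∣nCk⇒p^3t∣term t {n} {k} p^t∣nCk))
        where
        k+l≡n : k + (n ∸ k) ≡ n
        k+l≡n = m+[n∸m]≡n k≤n
        p^s∣l : p ^ s ∣ℕ n ∸ k
        p^s∣l = ∣m+n∣m⇒∣n (subst (p ^ s ∣ℕ_) (sym k+l≡n) (∣-trans (^-monoʳ-∣ p (m≤m+n s t)) p^r∣n)) p^s∣k
        exponent : ∀ s t → 3 * t + 3 * (1 + s) ≡ 3 * (1 + (s + t))
        exponent = solve-∀

      D-≈ : ∀ r {n} → p ^ r ∣ℕ n → D (n * p) a b c ≈ D n a b c [mod p ^ (3 * suc r) ]
      D-≈ r {n} p^r∣n = begin
        D (n * p) a b c                                  ≡⟨ sumTo≡sum (n * p) (T (n * p)) ⟩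
        sum (suc (n * p)) (T (n * p))                    ≡⟨ +-Fold.fold-suc (n * p) (T (n * p)) ⟩
        -- The term at k = 0 is set aside because `fold-multiples` counts from 1. It rejoins the sum
        -- as the multiple 0 · p.
        T (n * p) 0 + sum (n * p) (T (n * p) ∘′ suc)     ≈⟨ +-congˡ-≈ (T (n * p) 0) (+-Fold-≈.fold-multiples N p n (T (n * p)) λ k p∤k →
                                                              ∣⇒≈0 (p^t∣nCk⇒p^3t∣term (suc r) {n * p} {k} (p^[1+r]∣ k p∤k))) ⟩
        T (n * p) 0 + sum n (λ i → T (n * p) (suc i * p)) ≡⟨ +-Fold.fold-suc n (λ k → T (n * p) (k * p)) ⟨
        sum (suc n) (λ k → T (n * p) (k * p))            ≈⟨ +-Fold-≈.fold-cong N (suc n) (λ k k<1+n → term-≈ r p^r∣n (s≤s⁻¹ k<1+n)) ⟩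
        sum (suc n) (T n)                                ≡⟨ sumTo≡sum n (T n) ⟨
        D n a b c                                        ∎
        where
        N = p ^ (3 * suc r)
        open SetoidReasoning (≈-setoid N)
        p^[1+r]∣ : ∀ k → p ∤ k → p ^ suc r ∣ℕ (n * p) C k
        -- An index prime to p has s = 0, so all of pʳ⁺¹ passes from np to the binomial coefficient.
        p^[1+r]∣ k p∤k = subst (λ k → p ^ suc r ∣ℕ (n * p) C k) (*-identityʳ k)
          (p^t∣nC[k*p^s] 0 (suc r) (subst (p ^ suc r ∣ℕ_) (*-comm p n) (*-monoʳ-∣ p p^r∣n)) p∤k)

-- Passage to divisibility in the integers.

≈⇒∣ℤ : ∀ {N x y} → x ≈ y [mod N ] → ℤ.+ N ℤ.∣ ℤ.+ x ℤ.- ℤ.+ y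
-- From x + uN = y + vN the quotient of x - y by N is v - u, which may be negative.
≈⇒∣ℤ {N} {x} {y} (shifts u v e) = ℤSigned.∣⇒∣ᵤ (ℤSigned.divides (ℤ.+ v ℤ.- ℤ.+ u) (begin
  ℤ.+ x ℤ.- ℤ.+ y
    ≡⟨ add-subtract (ℤ.+ x) (ℤ.+ y) (ℤ.+ u) (ℤ.+ N) ⟩
  (ℤ.+ x ℤ.+ ℤ.+ u ℤ.* ℤ.+ N) ℤ.- ℤ.+ y ℤ.- ℤ.+ u ℤ.* ℤ.+ N
    ≡⟨ cong (λ z → z ℤ.- ℤ.+ y ℤ.- ℤ.+ u ℤ.* ℤ.+ N) cast ⟩
  (ℤ.+ y ℤ.+ ℤ.+ v ℤ.* ℤ.+ N) ℤ.- ℤ.+ y ℤ.- ℤ.+ u ℤ.* ℤ.+ N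
    ≡⟨ collect (ℤ.+ y) (ℤ.+ v) (ℤ.+ u) (ℤ.+ N) ⟩
  (ℤ.+ v ℤ.- ℤ.+ u) ℤ.* ℤ.+ N  ∎))
  where
  open ≡-Reasoning
  push : ∀ x u → ℤ.+ (x + u * N) ≡ ℤ.+ x ℤ.+ ℤ.+ u ℤ.* ℤ.+ N
  push x u = trans (ℤ.pos-+ x (u * N)) (cong (λ z → ℤ.+ x ℤ.+ z) (ℤ.pos-* u N))
  cast : ℤ.+ x ℤ.+ ℤ.+ u ℤ.* ℤ.+ N ≡ ℤ.+ y ℤ.+ ℤ.+ v ℤ.* ℤ.+ N
  cast = trans (sym (push x u)) (trans (cong (λ z → ℤ.+ z) e) (push y v))
  add-subtract : ∀ x y u N → x ℤ.- y ≡ (x ℤ.+ u ℤ.* N) ℤ.- y ℤ.- u ℤ.* N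
  add-subtract = ℤSolver.solve-∀
  collect : ∀ y v u N → (y ℤ.+ v ℤ.* N) ℤ.- y ℤ.- u ℤ.* N ≡ (v ℤ.- u) ℤ.* N
  collect = ℤSolver.solve-∀

open import Data.Integer using (+_; _-_)
open import Data.Integer.Divisibility using (_∣_)

theorem1p1 : (a b c p m r : ℕ) → 2 ≤ a → 1 ≤ b → 1 ≤ c → Prime p → 3 < p → 1 ≤ m → 1 ≤ r →
    (+ (p ^ (3 * r))) ∣ (+ D (m * p ^ r) a b c - + D (m * p ^ (r ∸ 1)) a b c)
theorem1p1 a b c p m (suc r) 2≤a 1≤b 1≤c p-prime 3<p _ _ =
  -- The congruence between D(np) and D(n) is taken at n = m pʳ, with r + 1 as the exponent of the
  -- statement.
  ≈⇒∣ℤ (subst (λ n → D n a b c ≈ D (m * p ^ r) a b c [mod p ^ (3 * suc r) ])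
    (trans (*-assoc m (p ^ r) p) (cong (m *_) (*-comm (p ^ r) p)))
    (D-≈ p-prime 3<p 2≤a 1≤b 1≤c r (n∣m*n m {p ^ r})))
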